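{- For a program $P$ and an input $x$, let $S_{P,x}(z)=\sum_{n=0}^{\infty} a_n z^n$, where $a_n = n!$ if $P(x)$ has halted by step $n$ and $a_n=0$ otherwise. Then determining whether $S_{P,x}(z)$ converges for some $z\in\mathbb{C}$, $z\neq 0$, is equivalent to solving the Halting Problem for $P$ and $x$: the coefficient sequence $(a_n)$ is effectively constructible from $(P,x)$, and $S_{P,x}(z)$ converges for some $z\neq 0$ if and only if $P$ does not halt on input $x$.
   Context: Programs are Turing machines (encoded by natural numbers). "$P(x)$ has halted by step $n$" means that the computation of $P$ on input $x$ reaches a halting state within at most $n$ steps. The Halting Problem is the decision problem: given a program $P$ and an input $x$, determine whether $P$ halts on input $x$. A power series converges at $z_0$ if its partial sums at $z_0$ converge in $\mathbb{C}$. "Effectively constructible" means there is an algorithm that, given (codes of) $P$, $x$ and $n$, outputs $a_n$. -}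

module Defs where

open import Data.Bool.Base using (if_then_else_)
open import Data.Empty using (⊥)
open import Data.Fin.Base as Fin using (Fin; zero; suc; toℕ; combine; remQuot; finToFun; funToFin)
open import Data.Fin.Properties as Fin
  using (remQuot-combine; finToFun-funToFin; toℕ<n; fromℕ<-toℕ; fromℕ<-cong)
open import Data.Integer.Base using (+_)
open import Data.List.Base using (List; []; _∷_; replicate)
open import Data.Nat.Base as ℕ using (ℕ; zero; suc; _≤_; _<_; _⊔_; _!; NonZero)
open import Data.Nat.DivMod using (_mod_; m%n<n; m<n⇒m%n≡m)
import Data.Nat.Properties as ℕ
open import Data.Product.Base using (∃-syntax; _×_; _,_; proj₁; proj₂)
open import Data.Rational.Base as ℚ using (ℚ; 0ℚ; 1ℚ; ½)
import Data.Rational.Properties as ℚ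
open import Data.Rational.Solver using (module +-*-Solver)
open import Data.Vec.Base as Vec using (Vec; []; _∷_)
open import Relation.Binary.PropositionalEquality
open import Relation.Nullary using (¬_; Dec; does)
open import Relation.Nullary.Decidable using (map′)

data Direction : Set where
  left right : Direction

-- Deterministic one-tape machines.  Symbol 0 is the blank and symbol 1 the
-- mark used to write inputs; state 0 is the halting state and state 1 the
-- initial state.  The values of δ at state 0 are never consulted.
record TuringMachine : Set where
  constructor machine
  field
    extraStates extraSymbols : ℕ

  State : Set
  State = Fin (2 ℕ.+ extraStates)

  Symbol : Set
  Symbol = Fin (2 ℕ.+ extraSymbols)

  field
    δ : State → Symbol → State × Symbol × Direction

  halting initial : State
  halting = zero
  initial = suc zero

  blank mark : Symbol
  blank = zero
  mark  = suc zero

-- The tape is infinite in both directions.  `before` lists the cells to the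
-- left of the head, nearest first, and `after` those to its right; all cells
-- beyond the ends of these lists are blank.
record Configuration (M : TuringMachine) : Set where
  constructor config
  open TuringMachine M
  field
    state  : State
    before : List Symbol
    cell   : Symbol
    after  : List Symbol

module _ (M : TuringMachine) where
  open TuringMachine M

  pop : List Symbol → Symbol × List Symbol
  pop []       = blank , []
  pop (s ∷ ss) = s , ss

  act : State × Symbol × Direction → List Symbol → List Symbol → Configuration M
  act (q , s , left)  ls rs = let (l , ls′) = pop ls in config q ls′ l (s ∷ rs)
  act (q , s , right) ls rs = let (r , rs′) = pop rs in config q (s ∷ ls) r rs′

  step : Configuration M → Configuration M
  step c@(config zero    _  _ _)  = c
  step   (config (suc q) ls s rs) = act (δ (suc q) s) ls rs

  -- The input x is written in unary, with the head on the leftmost mark.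
  start : ℕ → Configuration M
  start x = let (s , ss) = pop (replicate x mark) in config initial [] s ss

  run : ℕ → ℕ → Configuration M
  run x zero    = start x
  run x (suc n) = step (run x n)

  HaltsIn : ℕ → ℕ → Set
  HaltsIn x m = Configuration.state (run x m) ≡ halting

-- The n-th pair in Cantor's enumeration (0,0), (1,0), (0,1), (2,0), (1,1), …
nextPair : ℕ × ℕ → ℕ × ℕ
nextPair (zero  , b) = suc b , zero
nextPair (suc a , b) = a , suc b

unpair : ℕ → ℕ × ℕ
unpair zero    = zero , zero
unpair (suc n) = nextPair (unpair n)

#Actions : ℕ → ℕ → ℕ
#Actions Q G = Q ℕ.* (G ℕ.* 2)

#Tables : ℕ → ℕ → ℕ
#Tables Q G = #Actions Q G ℕ.^ (Q ℕ.* G)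

toDirection : Fin 2 → Direction
toDirection zero    = left
toDirection (suc _) = right

fromDirection : Direction → Fin 2
fromDirection left  = zero
fromDirection right = suc zero

toAction : ∀ {Q G} → Fin (#Actions Q G) → Fin Q × Fin G × Direction
toAction {Q} {G} i =
  let (q , j) = remQuot {Q} (G ℕ.* 2) i
      (s , d) = remQuot {G} 2 j
  in q , s , toDirection d

fromAction : ∀ {Q G} → Fin Q × Fin G × Direction → Fin (#Actions Q G)
fromAction (q , s , d) = combine q (combine s (fromDirection d))

#Tables≢0 : ∀ q g → NonZero (#Tables (2 ℕ.+ q) (2 ℕ.+ g))
#Tables≢0 q g = ℕ.m^n≢0 (#Actions (2 ℕ.+ q) (2 ℕ.+ g)) ((2 ℕ.+ q) ℕ.* (2 ℕ.+ g))

-- A number below #Tables, written in base #Actions, is a transition table: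
-- its digits are the entries.
entries : ∀ {Q G} → Fin (#Tables Q G) → Fin Q → Fin G → Fin Q × Fin G × Direction
entries t a s = toAction (finToFun t (combine a s))

table : ∀ q g → ℕ → let Q = 2 ℕ.+ q; G = 2 ℕ.+ g in Fin Q → Fin G → Fin Q × Fin G × Direction
table q g t = entries (_mod_ t (#Tables (2 ℕ.+ q) (2 ℕ.+ g)) {{#Tables≢0 q g}})

decode : ℕ → TuringMachine
decode P =
  let (q , r) = unpair P
      (g , t) = unpair r
  in machine q g (table q g t)

unpair-surjective : ∀ a b → ∃[ n ] unpair n ≡ (a , b)
unpair-surjective a b = onDiagonal (a ℕ.+ b) a b refl
  where
  onDiagonal : ∀ s a b → a ℕ.+ b ≡ s → ∃[ n ] unpair n ≡ (a , b)
  onDiagonal zero zero zero refl = zero , refl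
  onDiagonal (suc s) (suc a) zero eq =
    let (n , p) = onDiagonal s zero a (trans (sym (ℕ.+-identityʳ a)) (ℕ.suc-injective eq))
    in suc n , cong nextPair p
  onDiagonal s a (suc b) eq =
    let (n , p) = onDiagonal s (suc a) b (trans (sym (ℕ.+-suc a b)) eq)
    in suc n , cong nextPair p

toAction-fromAction : ∀ {Q G} (x : Fin Q × Fin G × Direction) → toAction (fromAction x) ≡ x
toAction-fromAction {Q} {G} (q , s , d) = begin
  toAction (fromAction (q , s , d))
    ≡⟨ cong (λ (q , j) → let (s , d) = remQuot {G} 2 j in q , s , toDirection d)
            (remQuot-combine {Q} {G ℕ.* 2} q (combine s (fromDirection d))) ⟩
  (let (s′ , d′) = remQuot {G} 2 (combine s (fromDirection d)) in q , s′ , toDirection d′)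
    ≡⟨ cong (λ (s , d) → q , s , toDirection d) (remQuot-combine {G} {2} s (fromDirection d)) ⟩
  q , s , toDirection (fromDirection d)
    ≡⟨ cong (λ d → q , s , d) (toDirection-fromDirection d) ⟩
  q , s , d ∎
  where
  open ≡-Reasoning
  toDirection-fromDirection : ∀ d → toDirection (fromDirection d) ≡ d
  toDirection-fromDirection left  = refl
  toDirection-fromDirection right = refl

toℕ-mod : ∀ {n} .{{_ : NonZero n}} (i : Fin n) → toℕ i mod n ≡ i
toℕ-mod {n} i = trans
  (fromℕ<-cong _ _ (m<n⇒m%n≡m (toℕ<n i)) (m%n<n (toℕ i) n) (toℕ<n i))
  (fromℕ<-toℕ i (toℕ<n i))

entries-surjective : ∀ {Q G} (δ : Fin Q → Fin G → Fin Q × Fin G × Direction) →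
  ∃[ t ] ∀ a s → entries t a s ≡ δ a s
entries-surjective {Q} {G} δ = funToFin entry , λ a s → trans
  (cong toAction (finToFun-funToFin entry (combine a s)))
  (trans (cong (λ (a , s) → toAction (fromAction (δ a s))) (remQuot-combine {Q} {G} a s))
         (toAction-fromAction (δ a s)))
  where
  entry : Fin (Q ℕ.* G) → Fin (#Actions Q G)
  entry i = let (a , s) = remQuot {Q} G i in fromAction (δ a s)

decode-unpair : ∀ P q r g t → unpair P ≡ (q , r) → unpair r ≡ (g , t) →
  decode P ≡ machine q g (table q g t)
decode-unpair P q r g t eq₁ eq₂ rewrite eq₁ | eq₂ = refl

-- Up to pointwise equality of transition functions, every machine has a code.
decode-surjective : ∀ q g (δ : Fin (2 ℕ.+ q) → Fin (2 ℕ.+ g) → Fin (2 ℕ.+ q) × Fin (2 ℕ.+ g) × Direction) →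
  ∃[ P ] ∃[ δ′ ] decode P ≡ machine q g δ′ × (∀ a s → δ′ a s ≡ δ a s)
decode-surjective q g δ =
  let (i , i-δ) = entries-surjective δ
      (r , r-gt) = unpair-surjective g (toℕ i)
      (P , P-qr) = unpair-surjective q r
  in P , table q g (toℕ i) , decode-unpair P q r g (toℕ i) P-qr r-gt ,
     λ a s → trans (cong (λ i → entries i a s) (toℕ-mod {{#Tables≢0 q g}} i)) (i-δ a s)

HaltedBy : (P x n : ℕ) → Set
HaltedBy P x n = ∃[ m ] m ≤ n × HaltsIn (decode P) x m

haltedBy? : ∀ P x n → Dec (HaltedBy P x n)
haltedBy? P x n = map′
  (λ { (m , ℕ.s≤s m≤n , h) → m , m≤n , h })
  (λ { (m , m≤n , h) → m , ℕ.s≤s m≤n , h })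
  (ℕ.anyUpTo? (λ m → Configuration.state (run (decode P) x m) Fin.≟ zero) (suc n))

Halts : (P x : ℕ) → Set
Halts P x = ∃[ n ] HaltedBy P x n

-- Partial recursive functions relative to an oracle.  O n is the set of names of the n-ary oracle functions.
data Code (O : ℕ → Set) : ℕ → Set where
  zeroᶜ  : ∀ {n} → Code O n
  sucᶜ   : Code O 1
  proj   : ∀ {n} → Fin n → Code O n
  comp   : ∀ {m n} → Code O m → Vec (Code O n) m → Code O n
  prec   : ∀ {n} → Code O n → Code O (2 ℕ.+ n) → Code O (suc n)
  μ      : ∀ {n} → Code O (suc n) → Code O n
  query  : ∀ {n} → O n → Code O n

module Evaluation {O : ℕ → Set} (answer : ∀ {n} → O n → Vec ℕ n → ℕ) where

  infix 4 _[_]⇓_ _[_]⇓*_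

  mutual
    data _[_]⇓_ : ∀ {n} → Code O n → Vec ℕ n → ℕ → Set where
      zero⇓  : ∀ {n} {xs : Vec ℕ n} → zeroᶜ [ xs ]⇓ 0
      suc⇓   : ∀ {x} → sucᶜ [ x ∷ [] ]⇓ suc x
      proj⇓  : ∀ {n} {i : Fin n} {xs} → proj i [ xs ]⇓ Vec.lookup xs i
      comp⇓  : ∀ {m n} {f : Code O m} {gs : Vec (Code O n) m} {xs ys y} →
               gs [ xs ]⇓* ys → f [ ys ]⇓ y → comp f gs [ xs ]⇓ y
      prec0⇓ : ∀ {n} {f : Code O n} {g xs y} →
               f [ xs ]⇓ y → prec f g [ 0 ∷ xs ]⇓ y
      precs⇓ : ∀ {n} {f : Code O n} {g k xs y z} →
               prec f g [ k ∷ xs ]⇓ y → g [ k ∷ y ∷ xs ]⇓ z → prec f g [ suc k ∷ xs ]⇓ z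
      μ⇓     : ∀ {n} {f : Code O (suc n)} {k xs} →
               f [ k ∷ xs ]⇓ 0 → (∀ i → i < k → ∃[ y ] f [ i ∷ xs ]⇓ suc y) → μ f [ xs ]⇓ k
      query⇓ : ∀ {n} {o : O n} {xs} → query o [ xs ]⇓ answer o xs

    data _[_]⇓*_ {n} : ∀ {m} → Vec (Code O n) m → Vec ℕ n → Vec ℕ m → Set where
      []  : ∀ {xs} → [] [ xs ]⇓* []
      _∷_ : ∀ {m} {f : Code O n} {fs : Vec (Code O n) m} {xs y ys} →
            f [ xs ]⇓ y → fs [ xs ]⇓* ys → (f ∷ fs) [ xs ]⇓* (y ∷ ys)

NoOracle : ℕ → Set
NoOracle _ = ⊥

noAnswer : ∀ {n} → NoOracle n → Vec ℕ n → ℕ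
noAnswer ()

EffectivelyConstructible : (ℕ → ℕ → ℕ → ℕ) → Set
EffectivelyConstructible a =
  ∃[ c ] ∀ P x n → c [ P ∷ x ∷ n ∷ [] ]⇓ a P x n
  where open Evaluation noAnswer

data BinaryOracle : ℕ → Set where
  oracle : BinaryOracle 2

answerBy : (ℕ → ℕ → ℕ) → ∀ {n} → BinaryOracle n → Vec ℕ n → ℕ
answerBy χ oracle (x ∷ y ∷ []) = χ x y

ComputableIn : (χ ψ : ℕ → ℕ → ℕ) → Set
ComputableIn χ ψ = ∃[ c ] ∀ x y → c [ x ∷ y ∷ [] ]⇓ ψ x y
  where open Evaluation (answerBy χ)

-- A decision problem on pairs (P , x) is given by its set of yes-instances.
DecisionProblem : Set₁
DecisionProblem = ℕ → ℕ → Set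

IsCharacteristicOf : (ℕ → ℕ → ℕ) → DecisionProblem → Set
IsCharacteristicOf χ A = ∀ P x → (A P x → χ P x ≡ 1) × (¬ A P x → χ P x ≡ 0)

infix 4 _≤ᵀ_ _≡ᵀ_

_≤ᵀ_ : DecisionProblem → DecisionProblem → Set
A ≤ᵀ B = ∀ χ → IsCharacteristicOf χ B → ∃[ ψ ] IsCharacteristicOf ψ A × ComputableIn χ ψ

_≡ᵀ_ : DecisionProblem → DecisionProblem → Set
A ≡ᵀ B = A ≤ᵀ B × B ≤ᵀ A

record ℝ : Set where
  constructor mkℝ
  field
    seq    : ℕ → ℚ
    cauchy : ∀ ε → 0ℚ ℚ.< ε → ∃[ N ] ∀ m n → N ≤ m → N ≤ n → ℚ.∣ seq m ℚ.- seq n ∣ ℚ.< ε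

open ℝ

infix 4 _≈ℝ_ _<ℝ_

_≈ℝ_ : ℝ → ℝ → Set
x ≈ℝ y = ∀ ε → 0ℚ ℚ.< ε → ∃[ N ] ∀ n → N ≤ n → ℚ.∣ seq x n ℚ.- seq y n ∣ ℚ.< ε

_<ℝ_ : ℝ → ℝ → Set
x <ℝ y = ∃[ ε ] 0ℚ ℚ.< ε × ∃[ N ] ∀ n → N ≤ n → seq x n ℚ.+ ε ℚ.≤ seq y n

fromℚ : ℚ → ℝ
fromℚ p = mkℝ (λ _ → p) λ ε 0<ε → 0 , λ _ _ _ _ →
  subst (λ d → ℚ.∣ d ∣ ℚ.< ε) (sym (ℚ.+-inverseʳ p)) 0<ε

0ℝ : ℝ
0ℝ = fromℚ 0ℚ

private
  half-pos : ∀ {ε} → 0ℚ ℚ.< ε → 0ℚ ℚ.< ½ ℚ.* ε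
  half-pos {ε} 0<ε = ℚ.positive⁻¹ _ {{ℚ.pos*pos⇒pos ½ ε {{ℚ.positive 0<ε}}}}

  half+half : ∀ ε → ½ ℚ.* ε ℚ.+ ½ ℚ.* ε ≡ ε
  half+half ε = trans (sym (ℚ.*-distribʳ-+ ε ½ ½)) (ℚ.*-identityˡ ε)

  bounded : (x : ℝ) → ∃[ B ] 0ℚ ℚ.< B × ∃[ N ] ∀ n → N ≤ n → ℚ.∣ seq x n ∣ ℚ.≤ B
  bounded x = 1ℚ ℚ.+ ℚ.∣ seq x N ∣ , 0<B , N , bound
    where
    0<1 : 0ℚ ℚ.< 1ℚ
    0<1 = ℚ.positive⁻¹ 1ℚ
    N = proj₁ (cauchy x 1ℚ 0<1)
    0<B : 0ℚ ℚ.< 1ℚ ℚ.+ ℚ.∣ seq x N ∣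
    0<B = ℚ.positive⁻¹ _ {{ℚ.pos+nonNeg⇒pos 1ℚ ℚ.∣ seq x N ∣ {{ℚ.∣-∣-nonNeg (seq x N)}}}}
    bound : ∀ n → N ≤ n → ℚ.∣ seq x n ∣ ℚ.≤ 1ℚ ℚ.+ ℚ.∣ seq x N ∣
    bound n N≤n = begin
      ℚ.∣ a ∣                     ≡⟨ cong ℚ.∣_∣ (solve 2 (λ a b → a := (a :- b) :+ b) refl a b) ⟩
      ℚ.∣ (a ℚ.- b) ℚ.+ b ∣       ≤⟨ ℚ.∣p+q∣≤∣p∣+∣q∣ (a ℚ.- b) b ⟩
      ℚ.∣ a ℚ.- b ∣ ℚ.+ ℚ.∣ b ∣   ≤⟨ ℚ.+-monoˡ-≤ ℚ.∣ b ∣ (ℚ.<⇒≤ (proj₂ (cauchy x 1ℚ 0<1) n N N≤n ℕ.≤-refl)) ⟩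
      1ℚ ℚ.+ ℚ.∣ b ∣              ∎
      where
      open ℚ.≤-Reasoning
      open +-*-Solver
      a = seq x n
      b = seq x N

  -- Some η > 0 with B * η = ε / 2.
  share : ∀ B ε → 0ℚ ℚ.< B → 0ℚ ℚ.< ε → ∃[ η ] 0ℚ ℚ.< η × B ℚ.* η ≡ ½ ℚ.* ε
  share B ε 0<B 0<ε = B⁻¹ ℚ.* (½ ℚ.* ε) , 0<η , eq
    where
    instance
      B-pos : ℚ.Positive B
      B-pos = ℚ.positive 0<B
      B≢0 : ℚ.NonZero B
      B≢0 = ℚ.pos⇒nonZero B
    B⁻¹ = ℚ.1/ B
    0<η : 0ℚ ℚ.< B⁻¹ ℚ.* (½ ℚ.* ε)
    0<η = ℚ.positive⁻¹ _
      {{ℚ.pos*pos⇒pos B⁻¹ {{ℚ.1/pos⇒pos B}} (½ ℚ.* ε) {{ℚ.positive (half-pos 0<ε)}}}}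
    eq : B ℚ.* (B⁻¹ ℚ.* (½ ℚ.* ε)) ≡ ½ ℚ.* ε
    eq = trans (sym (ℚ.*-assoc B B⁻¹ (½ ℚ.* ε)))
        (trans (cong (ℚ._* (½ ℚ.* ε)) (ℚ.*-inverseʳ B)) (ℚ.*-identityˡ (½ ℚ.* ε)))

  scaled : ∀ {a d B η} → ℚ.∣ a ∣ ℚ.≤ B → 0ℚ ℚ.< B → ℚ.∣ d ∣ ℚ.< η → ℚ.∣ a ℚ.* d ∣ ℚ.< B ℚ.* η
  scaled {a} {d} {B} {η} a≤B 0<B d<η = begin-strict
    ℚ.∣ a ℚ.* d ∣         ≡⟨ ℚ.∣p*q∣≡∣p∣*∣q∣ a d ⟩
    ℚ.∣ a ∣ ℚ.* ℚ.∣ d ∣   ≤⟨ ℚ.*-monoʳ-≤-nonNeg ℚ.∣ d ∣ {{ℚ.∣-∣-nonNeg d}} a≤B ⟩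
    B ℚ.* ℚ.∣ d ∣         <⟨ ℚ.*-monoʳ-<-pos B {{ℚ.positive 0<B}} d<η ⟩
    B ℚ.* η               ∎
    where open ℚ.≤-Reasoning

  split : ∀ {a b ε} → ℚ.∣ a ∣ ℚ.< ½ ℚ.* ε → ℚ.∣ b ∣ ℚ.< ½ ℚ.* ε → ℚ.∣ a ℚ.+ b ∣ ℚ.< ε
  split {a} {b} {ε} a< b< = begin-strict
    ℚ.∣ a ℚ.+ b ∣           ≤⟨ ℚ.∣p+q∣≤∣p∣+∣q∣ a b ⟩
    ℚ.∣ a ∣ ℚ.+ ℚ.∣ b ∣     <⟨ ℚ.+-mono-< a< b< ⟩
    ½ ℚ.* ε ℚ.+ ½ ℚ.* ε     ≡⟨ half+half ε ⟩
    ε                       ∎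
    where open ℚ.≤-Reasoning

infixl 6 _+ℝ_ _-ℝ_
infixl 7 _*ℝ_
infix  8 -ℝ_

_+ℝ_ : ℝ → ℝ → ℝ
x +ℝ y = mkℝ (λ n → seq x n ℚ.+ seq y n) proof
  where
  open +-*-Solver
  proof : ∀ ε → 0ℚ ℚ.< ε → ∃[ N ] ∀ m n → N ≤ m → N ≤ n →
    ℚ.∣ (seq x m ℚ.+ seq y m) ℚ.- (seq x n ℚ.+ seq y n) ∣ ℚ.< ε
  proof ε 0<ε =
    let (N₁ , p) = cauchy x (½ ℚ.* ε) (half-pos 0<ε)
        (N₂ , q) = cauchy y (½ ℚ.* ε) (half-pos 0<ε)
    in N₁ ⊔ N₂ , λ m n hm hn →
      subst (λ d → ℚ.∣ d ∣ ℚ.< ε)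
        (solve 4 (λ a b c d → (a :- c) :+ (b :- d) := (a :+ b) :- (c :+ d)) refl
          (seq x m) (seq y m) (seq x n) (seq y n))
        (split (p m n (ℕ.m⊔n≤o⇒m≤o N₁ N₂ hm) (ℕ.m⊔n≤o⇒m≤o N₁ N₂ hn))
               (q m n (ℕ.m⊔n≤o⇒n≤o N₁ N₂ hm) (ℕ.m⊔n≤o⇒n≤o N₁ N₂ hn)))

-ℝ_ : ℝ → ℝ
-ℝ x = mkℝ (λ n → ℚ.- seq x n) λ ε 0<ε →
  let (N , p) = cauchy x ε 0<ε
  in N , λ m n hm hn →
    subst (ℚ._< ε)
      (trans (sym (ℚ.∣-p∣≡∣p∣ (seq x m ℚ.- seq x n)))
             (cong ℚ.∣_∣ (ℚ.neg-distrib-+ (seq x m) (ℚ.- seq x n))))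
      (p m n hm hn)

_-ℝ_ : ℝ → ℝ → ℝ
x -ℝ y = x +ℝ (-ℝ y)

_*ℝ_ : ℝ → ℝ → ℝ
x *ℝ y = mkℝ (λ n → seq x n ℚ.* seq y n) proof
  where
  open +-*-Solver
  proof : ∀ ε → 0ℚ ℚ.< ε → ∃[ N ] ∀ m n → N ≤ m → N ≤ n →
    ℚ.∣ seq x m ℚ.* seq y m ℚ.- seq x n ℚ.* seq y n ∣ ℚ.< ε
  proof ε 0<ε =
    let (A , 0<A , N₁ , x≤A) = bounded x
        (B , 0<B , N₂ , y≤B) = bounded y
        (α , 0<α , Aα) = share A ε 0<A 0<ε
        (β , 0<β , Bβ) = share B ε 0<B 0<ε
        (N₃ , q) = cauchy y α 0<α
        (N₄ , p) = cauchy x β 0<β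
        N₁₂ = N₁ ⊔ N₂
        N₃₄ = N₃ ⊔ N₄
        to₁ : ∀ {k} → N₁₂ ⊔ N₃₄ ≤ k → N₁ ≤ k
        to₁ h = ℕ.m⊔n≤o⇒m≤o N₁ N₂ (ℕ.m⊔n≤o⇒m≤o N₁₂ N₃₄ h)
        to₂ : ∀ {k} → N₁₂ ⊔ N₃₄ ≤ k → N₂ ≤ k
        to₂ h = ℕ.m⊔n≤o⇒n≤o N₁ N₂ (ℕ.m⊔n≤o⇒m≤o N₁₂ N₃₄ h)
        to₃ : ∀ {k} → N₁₂ ⊔ N₃₄ ≤ k → N₃ ≤ k
        to₃ h = ℕ.m⊔n≤o⇒m≤o N₃ N₄ (ℕ.m⊔n≤o⇒n≤o N₁₂ N₃₄ h)
        to₄ : ∀ {k} → N₁₂ ⊔ N₃₄ ≤ k → N₄ ≤ k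
        to₄ h = ℕ.m⊔n≤o⇒n≤o N₃ N₄ (ℕ.m⊔n≤o⇒n≤o N₁₂ N₃₄ h)
    in N₁₂ ⊔ N₃₄ , λ m n hm hn →
      subst (λ d → ℚ.∣ d ∣ ℚ.< ε)
        (solve 4 (λ a b c d → a :* (b :- d) :+ d :* (a :- c) := a :* b :- c :* d) refl
          (seq x m) (seq y m) (seq x n) (seq y n))
        (split
          (subst (ℚ.∣ seq x m ℚ.* (seq y m ℚ.- seq y n) ∣ ℚ.<_) Aα
            (scaled (x≤A m (to₁ hm)) 0<A (q m n (to₃ hm) (to₃ hn))))
          (subst (ℚ.∣ seq y n ℚ.* (seq x m ℚ.- seq x n) ∣ ℚ.<_) Bβ
            (scaled (y≤B n (to₂ hn)) 0<B (p m n (to₄ hm) (to₄ hn)))))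

infix 4 _≈_ _≉_

record ℂ : Set where
  constructor _+i_
  field
    re im : ℝ

open ℂ

_≈_ _≉_ : ℂ → ℂ → Set
z ≈ w = re z ≈ℝ re w × im z ≈ℝ im w
z ≉ w = ¬ (z ≈ w)

0ℂ 1ℂ : ℂ
0ℂ = 0ℝ +i 0ℝ
1ℂ = fromℚ 1ℚ +i 0ℝ

fromℕ : ℕ → ℂ
fromℕ n = fromℚ (+ n ℚ./ 1) +i 0ℝ

infixl 6 _+_ _-_
infixl 7 _*_
infixr 8 _^_

_+_ _-_ _*_ : ℂ → ℂ → ℂ
z + w = (re z +ℝ re w) +i (im z +ℝ im w)
z - w = (re z -ℝ re w) +i (im z -ℝ im w)
z * w = (re z *ℝ re w -ℝ im z *ℝ im w) +i (re z *ℝ im w +ℝ im z *ℝ re w)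

_^_ : ℂ → ℕ → ℂ
z ^ zero  = 1ℂ
z ^ suc n = z * z ^ n

∣_∣² : ℂ → ℝ
∣ z ∣² = re z *ℝ re z +ℝ im z *ℝ im z

-- For ε > 0, the condition |s n - w| < ε is written |s n - w|² < ε².
_⟶_ : (ℕ → ℂ) → ℂ → Set
s ⟶ w = ∀ ε → 0ℝ <ℝ ε → ∃[ N ] ∀ n → N ≤ n → ∣ s n - w ∣² <ℝ ε *ℝ ε

Convergent : (ℕ → ℂ) → Set
Convergent s = ∃[ w ] s ⟶ w

PowerSeries : Set
PowerSeries = ℕ → ℂ

-- The sum of the terms of degree less than the given number.
partialSum : PowerSeries → ℂ → ℕ → ℂ
partialSum a z zero    = 0ℂ
partialSum a z (suc n) = partialSum a z n + a n * z ^ n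

_ConvergesAt_ : PowerSeries → ℂ → Set
a ConvergesAt z = Convergent (partialSum a z)

coeff : (P x n : ℕ) → ℕ
coeff P x n = if does (haltedBy? P x n) then n ! else 0

S : (P x : ℕ) → PowerSeries
S P x n = fromℕ (coeff P x n)

ConvergesSomewhere : DecisionProblem
ConvergesSomewhere P x = ∃[ z ] z ≉ 0ℂ × S P x ConvergesAt z

module Submission where

-- If P never halts on x, every coefficient is 0 and the series converges
-- everywhere.  Otherwise the coefficients are eventually n!, and convergence at z
-- bounds the terms by |n! zⁿ|² ≤ 4; as soon as |z|² stays above 1/M this gives
-- n!² ≤ 4 Mⁿ for all large n, which fails, so z = 0.  For the constructibility of
-- the coefficients, a tape is stored as the two numbers whose base G digits are
-- the symbols on either side of the head (G is the number of symbols, and the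
-- digit 0 is the blank), so that one step of a machine is a division with
-- remainder followed by a table lookup, itself the extraction of a digit.

open import Defs hiding (_+_; _-_; _*_; _^_)
open import Data.Bool.Base using (if_then_else_)
open import Data.Empty using (⊥-elim)
open import Data.Fin.Base using (Fin; zero; suc; toℕ; combine; remQuot; finToFun)
open import Data.Fin.Patterns using (0F; 1F; 2F; 3F; 4F; 5F)
open import Data.Fin.Properties using (toℕ<n; toℕ-fromℕ<; toℕ-combine; combine-remQuot)
open import Data.Integer.Base as ℤ using (+_)
import Data.Integer.Properties as ℤ
open import Data.List.Base using (List; []; _∷_; replicate)
open import Data.Nat.Base
open import Data.Nat.Coprimality using (1-coprimeTo) renaming (sym to coprime-sym)
open import Data.Nat.Divisibility using (divides-refl; m∣m*n)
open import Data.Nat.DivMod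
open import Data.Nat.Properties
open import Data.Product.Base using (_×_; ∃-syntax; _,_; proj₁; proj₂)
open import Data.Rational.Base as ℚ using (ℚ; mkℚ; 0ℚ; 1ℚ)
import Data.Rational.Properties as ℚ
open import Data.Rational.Solver using (module +-*-Solver)
open import Data.Sum.Base using (_⊎_; inj₁; inj₂)
open import Data.Vec.Base using (Vec; []; _∷_; lookup)
open import Function.Bundles using (_⇔_; mk⇔; Equivalence)
open import Relation.Binary.PropositionalEquality
open import Relation.Nullary using (¬_; Dec; yes; no; contradiction)
open import Relation.Nullary.Decidable using (dec-true; dec-false; decidable-stable)

open ℂ
open ℝ

-- Recursive functions

module Computability {O : ℕ → Set} (answer : ∀ {n} → O n → Vec ℕ n → ℕ) where
  open Evaluation answer

  Computable : ∀ {n} → (Vec ℕ n → ℕ) → Set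
  Computable {n} f = ∃[ c ] ∀ xs → c [ xs ]⇓ f xs

  Computables : ∀ {m n} → (Vec ℕ n → Vec ℕ m) → Set
  Computables {m} {n} fs = ∃[ cs ] ∀ xs → cs [ xs ]⇓* fs xs

  private variable
    m n : ℕ
    f g h : Vec ℕ n → ℕ
    fs : Vec ℕ n → Vec ℕ m

  [_]ᶜ : Computable f → Computables (λ xs → f xs ∷ [])
  [ c , c⇓ ]ᶜ = c ∷ [] , λ xs → c⇓ xs ∷ []

  infixr 5 _∷ᶜ_
  _∷ᶜ_ : Computable f → Computables fs → Computables (λ xs → f xs ∷ fs xs)
  (c , c⇓) ∷ᶜ (cs , cs⇓) = c ∷ cs , λ xs → c⇓ xs ∷ cs⇓ xs

  infixr 9 _∘ᶜ_
  _∘ᶜ_ : Computable f → Computables fs → Computable (λ xs → f (fs xs))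
  (c , c⇓) ∘ᶜ (cs , cs⇓) = comp c cs , λ xs → comp⇓ (cs⇓ xs) (c⇓ _)

  ext : (∀ xs → f xs ≡ g xs) → Computable f → Computable g
  ext f≗g (c , c⇓) = c , λ xs → subst (c [ xs ]⇓_) (f≗g xs) (c⇓ xs)

  varᶜ : (i : Fin n) → Computable (λ xs → lookup xs i)
  varᶜ i = proj i , λ _ → proj⇓

  constᶜ : ∀ k → Computable {n} (λ _ → k)
  constᶜ zero    = zeroᶜ , λ _ → zero⇓
  constᶜ (suc k) = let (c , c⇓) = constᶜ k in comp sucᶜ (c ∷ []) , λ xs → comp⇓ (c⇓ xs ∷ []) suc⇓

  1+ᶜ_ : Computable f → Computable (λ xs → suc (f xs))
  1+ᶜ (c , c⇓) = comp sucᶜ (c ∷ []) , λ xs → comp⇓ (c⇓ xs ∷ []) suc⇓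

  -- The function `h` is given in advance and only has to satisfy the recursion equations pointwise,
  -- so `b` and `s` may be any convenient representatives of the base case and the step.
  precᶜ : {b : Vec ℕ n → ℕ} {s : Vec ℕ (2 + n) → ℕ} {h : Vec ℕ (suc n) → ℕ} →
    Computable b → (∀ xs → b xs ≡ h (0 ∷ xs)) →
    Computable s → (∀ k xs → s (k ∷ h (k ∷ xs) ∷ xs) ≡ h (suc k ∷ xs)) →
    Computable h
  precᶜ {h = h} (b , b⇓) b≗ (s , s⇓) s≗ = prec b s , λ { (k ∷ xs) → evaluate k xs }
    where
    evaluate : ∀ k xs → prec b s [ k ∷ xs ]⇓ h (k ∷ xs)
    evaluate zero    xs = subst (_ [ _ ]⇓_) (b≗ xs) (prec0⇓ (b⇓ xs))
    evaluate (suc k) xs = subst (_ [ _ ]⇓_) (s≗ k xs) (precs⇓ (evaluate k xs) (s⇓ _))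

  -- The last two hypotheses make the unbounded search total: it stops exactly at `h xs`.
  μᶜ : {p : Vec ℕ (suc n) → ℕ} {h : Vec ℕ n → ℕ} → Computable p →
    (∀ xs → p (h xs ∷ xs) ≡ 0) → (∀ xs i → i < h xs → 0 < p (i ∷ xs)) → Computable h
  μᶜ {p = p} {h} (c , c⇓) root least = μ c , λ xs → μ⇓
    (subst (c [ _ ]⇓_) (root xs) (c⇓ (h xs ∷ xs)))
    (λ i i<h → pred (p (i ∷ xs)) ,
      subst (c [ _ ]⇓_) (sym (suc-pred _ {{>-nonZero (least xs i i<h)}})) (c⇓ (i ∷ xs)))

  infixl 6 _+ᶜ_ _∸ᶜ_
  infixl 7 _*ᶜ_
  infixr 8 _^ᶜ_

  _+ᶜ_ : Computable f → Computable g → Computable (λ xs → f xs + g xs)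
  f +ᶜ g = add ∘ᶜ (f ∷ᶜ [ g ]ᶜ)
    where
    add : Computable {2} λ { (m ∷ n ∷ []) → m + n }
    add = precᶜ (varᶜ 0F) (λ { (n ∷ []) → refl })
                (1+ᶜ varᶜ 1F) (λ { k (n ∷ []) → refl })

  _*ᶜ_ : Computable f → Computable g → Computable (λ xs → f xs * g xs)
  f *ᶜ g = mul ∘ᶜ (f ∷ᶜ [ g ]ᶜ)
    where
    mul : Computable {2} λ { (m ∷ n ∷ []) → m * n }
    mul = precᶜ (constᶜ 0) (λ { (n ∷ []) → refl })
                (varᶜ 2F +ᶜ varᶜ 1F) (λ { k (n ∷ []) → refl })

  _^ᶜ_ : Computable f → Computable g → Computable (λ xs → f xs ^ g xs)
  f ^ᶜ g = power ∘ᶜ (g ∷ᶜ [ f ]ᶜ)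
    where
    power : Computable {2} λ { (m ∷ n ∷ []) → n ^ m }
    power = precᶜ (constᶜ 1) (λ { (n ∷ []) → refl })
                  (varᶜ 2F *ᶜ varᶜ 1F) (λ { k (n ∷ []) → refl })

  _!ᶜ : Computable f → Computable (λ xs → f xs !)
  f !ᶜ = factorial ∘ᶜ [ f ]ᶜ
    where
    factorial : Computable {1} λ { (m ∷ []) → m ! }
    factorial = precᶜ (constᶜ 1) (λ { [] → refl })
                      ((1+ᶜ varᶜ 0F) *ᶜ varᶜ 1F) (λ { k [] → refl })

  predᶜ : Computable f → Computable (λ xs → pred (f xs))
  predᶜ f = predecessor ∘ᶜ [ f ]ᶜ
    where
    predecessor : Computable {1} λ { (m ∷ []) → pred m }
    predecessor = precᶜ (constᶜ 0) (λ { [] → refl }) (varᶜ 0F) (λ { k [] → refl })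

  _∸ᶜ_ : Computable f → Computable g → Computable (λ xs → f xs ∸ g xs)
  f ∸ᶜ g = monus ∘ᶜ (g ∷ᶜ [ f ]ᶜ)
    where
    monus : Computable {2} λ { (m ∷ n ∷ []) → n ∸ m }
    monus = precᶜ (varᶜ 0F) (λ { (n ∷ []) → refl })
                  (predᶜ (varᶜ 1F)) (λ { k (n ∷ []) → pred[m∸n]≡m∸[1+n] n k })

  if0ᶜ : Computable f → Computable g → Computable h →
    Computable (λ xs → if f xs ≡ᵇ 0 then g xs else h xs)
  if0ᶜ f g h = cases ∘ᶜ (f ∷ᶜ g ∷ᶜ [ h ]ᶜ)
    where
    cases : Computable {3} λ { (k ∷ m ∷ n ∷ []) → if k ≡ᵇ 0 then m else n }
    cases = precᶜ (varᶜ 0F) (λ { (m ∷ n ∷ []) → refl }) (varᶜ 3F) (λ { k (m ∷ n ∷ []) → refl })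

  -- Minimisation finds the quotient as the least `i` for which the dividend is less than `i + 1`
  -- times the divisor. The divisor is passed as its predecessor, so that `quotient` is total on all
  -- vectors.
  divideᶜ : Computable f → Computable g → (g≢0 : ∀ xs → NonZero (g xs)) →
    Computable (λ xs → (f xs / g xs) {{g≢0 xs}})
  divideᶜ {g = g} c d g≢0 = ext
    (λ xs → /-congʳ {{_}} {{g≢0 xs}} (suc-pred (g xs) {{g≢0 xs}}))
    (quotient ∘ᶜ (c ∷ᶜ [ predᶜ d ]ᶜ))
    where
    quotient : Computable {2} λ { (m ∷ d ∷ []) → m / suc d }
    quotient = μᶜ (1+ᶜ varᶜ 1F ∸ᶜ (1+ᶜ varᶜ 0F) *ᶜ (1+ᶜ varᶜ 2F))
      (λ { (m ∷ d ∷ []) → m≤n⇒m∸n≡0 (subst (_< suc (m / suc d) * suc d)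
             (sym (m≡m%n+[m/n]*n m (suc d))) (+-monoˡ-< (m / suc d * suc d) (m%n<n m (suc d)))) })
      (λ { (m ∷ d ∷ []) i i<q → m<n⇒0<n∸m (s≤s (≤-trans (*-monoˡ-≤ (suc d) i<q) (m/n*n≤m m (suc d)))) })

  moduloᶜ : Computable f → Computable g → (g≢0 : ∀ xs → NonZero (g xs)) →
    Computable (λ xs → (f xs % g xs) {{g≢0 xs}})
  moduloᶜ {f = f} {g = g} c d g≢0 = ext
    (λ xs → sym (m%n≡m∸m/n*n (f xs) (g xs) {{g≢0 xs}}))
    (c ∸ᶜ divideᶜ c d g≢0 *ᶜ d)

-- Cantor's enumeration

triangle : ℕ → ℕ
triangle zero    = 0
triangle (suc n) = suc n + triangle n

triangle-mono : ∀ {m n} → m ≤ n → triangle m ≤ triangle n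
triangle-mono z≤n       = z≤n
triangle-mono (s≤s m≤n) = +-mono-≤ (s≤s m≤n) (triangle-mono m≤n)

-- Closed form of the inverse of `unpair`: the diagonals of smaller sum take up `triangle (a + b)`
-- indices, and `b` is the position on the diagonal.
pair : ℕ → ℕ → ℕ
pair a b = triangle (a + b) + b

fst snd : ℕ → ℕ
fst n = proj₁ (unpair n)
snd n = proj₂ (unpair n)

pair-unpair : ∀ n → pair (fst n) (snd n) ≡ n
pair-unpair zero    = refl
pair-unpair (suc n) with unpair n | pair-unpair n
... | zero  , b | eq = begin
  triangle (suc b + 0) + 0   ≡⟨ +-identityʳ _ ⟩
  triangle (suc b + 0)       ≡⟨ cong triangle (+-identityʳ (suc b)) ⟩
  suc (b + triangle b)       ≡⟨ cong suc (+-comm b (triangle b)) ⟩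
  suc (triangle b + b)       ≡⟨ cong suc eq ⟩
  suc n                      ∎
  where open ≡-Reasoning
... | suc a , b | eq = begin
  triangle (a + suc b) + suc b     ≡⟨ cong (λ s → triangle s + suc b) (+-suc a b) ⟩
  triangle (suc (a + b)) + suc b   ≡⟨ +-suc _ b ⟩
  suc (triangle (suc a + b) + b)   ≡⟨ cong suc eq ⟩
  suc n                            ∎
  where open ≡-Reasoning

-- Surjectivity writes `(a , b)` as `unpair n`, and `pair-unpair` then identifies `n` with
-- `pair a b`.
unpair-pair : ∀ a b → unpair (pair a b) ≡ (a , b)
unpair-pair a b with n , eq ← unpair-surjective a b =
  trans (cong unpair (trans (sym (cong (λ (a , b) → pair a b) eq)) (pair-unpair n))) eq

fst-pair : ∀ a b → fst (pair a b) ≡ a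
fst-pair a b = cong proj₁ (unpair-pair a b)

snd-pair : ∀ a b → snd (pair a b) ≡ b
snd-pair a b = cong proj₂ (unpair-pair a b)

module _ {O : ℕ → Set} {answer : ∀ {n} → O n → Vec ℕ n → ℕ} where
  open Computability answer

  private variable
    n : ℕ
    f g : Vec ℕ n → ℕ

  triangleᶜ : Computable f → Computable (λ xs → triangle (f xs))
  triangleᶜ f = triangular ∘ᶜ [ f ]ᶜ
    where
    triangular : Computable {1} λ { (m ∷ []) → triangle m }
    triangular = precᶜ (constᶜ 0) (λ { [] → refl })
                       ((1+ᶜ varᶜ 0F) +ᶜ varᶜ 1F) (λ { k [] → refl })

  pairᶜ : Computable f → Computable g → Computable (λ xs → pair (f xs) (g xs))
  pairᶜ f g = triangleᶜ (f +ᶜ g) +ᶜ g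

  -- The sum of the components of unpair n is the least k with n < triangle (k + 1).
  diagonalᶜ : Computable {1} λ { (n ∷ []) → fst n + snd n }
  diagonalᶜ = μᶜ (1+ᶜ varᶜ 1F ∸ᶜ triangleᶜ (1+ᶜ varᶜ 0F))
    (λ { (n ∷ []) → m≤n⇒m∸n≡0 (subst (_< triangle (suc (fst n + snd n))) (pair-unpair n) (begin-strict
      triangle (fst n + snd n) + snd n              ≤⟨ +-monoʳ-≤ _ (m≤n+m (snd n) (fst n)) ⟩
      triangle (fst n + snd n) + (fst n + snd n)    ≡⟨ +-comm _ (fst n + snd n) ⟩
      (fst n + snd n) + triangle (fst n + snd n)    <⟨ n<1+n _ ⟩
      triangle (suc (fst n + snd n))                ∎)) })
    (λ { (n ∷ []) i i<s → m<n⇒0<n∸m (s≤s (begin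
      triangle (suc i)                    ≤⟨ triangle-mono i<s ⟩
      triangle (fst n + snd n)            ≤⟨ m≤m+n _ (snd n) ⟩
      triangle (fst n + snd n) + snd n    ≡⟨ pair-unpair n ⟩
      n                                   ∎)) })
    where open ≤-Reasoning

  sndᶜ : Computable f → Computable (λ xs → snd (f xs))
  sndᶜ c = second ∘ᶜ [ c ]ᶜ
    where
    second : Computable {1} λ { (n ∷ []) → snd n }
    second = ext (λ { (n ∷ []) → trans
        (cong (_∸ triangle (fst n + snd n)) (sym (pair-unpair n)))
        (m+n∸m≡n (triangle (fst n + snd n)) (snd n)) })
      (varᶜ 0F ∸ᶜ triangleᶜ diagonalᶜ)

  fstᶜ : Computable f → Computable (λ xs → fst (f xs))
  fstᶜ c = first ∘ᶜ [ c ]ᶜ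
    where
    first : Computable {1} λ { (n ∷ []) → fst n }
    first = ext (λ { (n ∷ []) → m+n∸n≡m (fst n) (snd n) }) (diagonalᶜ ∸ᶜ sndᶜ (varᶜ 0F))

-- Machines on numbers

remainder-unique : ∀ r q n .{{_ : NonZero n}} → r < n → (r + q * n) % n ≡ r
remainder-unique r q n r<n = trans ([m+kn]%n≡m%n r q n) (m<n⇒m%n≡m r<n)

quotient-unique : ∀ r q n .{{_ : NonZero n}} → r < n → (r + q * n) / n ≡ q
quotient-unique r q n r<n = begin
  (r + q * n) / n       ≡⟨ +-distrib-/-∣ʳ r (divides-refl q) ⟩
  r / n + q * n / n     ≡⟨ cong₂ _+_ (m<n⇒m/n≡0 r<n) (m*n/n≡m q n) ⟩
  q                     ∎
  where open ≡-Reasoning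

toℕ-remQuot : ∀ {m} n (i : Fin (m * n)) →
  let (q , r) = remQuot {m} n i in toℕ r + toℕ q * n ≡ toℕ i
toℕ-remQuot {m} n i = let (q , r) = remQuot {m} n i in begin
  toℕ r + toℕ q * n   ≡⟨ +-comm (toℕ r) _ ⟩
  toℕ q * n + toℕ r   ≡⟨ cong (_+ toℕ r) (*-comm (toℕ q) n) ⟩
  n * toℕ q + toℕ r   ≡⟨ toℕ-combine q r ⟨
  toℕ (combine q r)   ≡⟨ cong toℕ (combine-remQuot {m} n i) ⟩
  toℕ i               ∎
  where open ≡-Reasoning

toℕ-quotient : ∀ {m} n .{{_ : NonZero n}} (i : Fin (m * n)) →
  toℕ (proj₁ (remQuot {m} n i)) ≡ toℕ i / n
toℕ-quotient {m} n i = let (q , r) = remQuot {m} n i in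
  trans (sym (quotient-unique (toℕ r) (toℕ q) n (toℕ<n r))) (cong (_/ n) (toℕ-remQuot {m} n i))

toℕ-remainder : ∀ {m} n .{{_ : NonZero n}} (i : Fin (m * n)) →
  toℕ (proj₂ (remQuot {m} n i)) ≡ toℕ i % n
toℕ-remainder {m} n i = let (q , r) = remQuot {m} n i in
  trans (sym (remainder-unique (toℕ r) (toℕ q) n (toℕ<n r))) (cong (_% n) (toℕ-remQuot {m} n i))

digit : ∀ m .{{_ : NonZero m}} → ℕ → ℕ → ℕ
digit m k i = (i / m ^ k) {{m^n≢0 m k}} % m

-- The equation for `n` places position `k` below `n`. Since `m ^ n` is `m * m ^ j` times `m ^ k`,
-- division by `m ^ k` turns a remainder modulo `m ^ n` into one modulo `m * m ^ j`, which keeps the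
-- last digit.
digit-% : ∀ m k j n i .{{_ : NonZero m}} → n ≡ k + suc j →
  digit m k ((i % m ^ n) {{m^n≢0 m n}}) ≡ digit m k i
digit-% m k j n i refl = begin
  i % m ^ (k + suc j) / m ^ k % m
    ≡⟨ cong (λ r → r / m ^ k % m) (%-congʳ {m = m ^ (k + suc j)} m^n) ⟩
  i % (m * m ^ j * m ^ k) / m ^ k % m
    ≡⟨ cong (_% m) (m%[n*o]/o≡m/o%n i (m * m ^ j) (m ^ k)) ⟩
  i / m ^ k % (m * m ^ j) % m                 ≡⟨ m∣n⇒o%n%m≡o%m m (m * m ^ j) _ (m∣m*n (m ^ j)) ⟩
  i / m ^ k % m                               ∎
  where
  open ≡-Reasoning
  instance
    _ = m^n≢0 m (k + suc j)
    _ = m^n≢0 m k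
    _ = m^n≢0 m j
    _ = m*n≢0 m (m ^ j)
    _ = m*n≢0 (m * m ^ j) (m ^ k)
  m^n : m ^ (k + suc j) ≡ m * m ^ j * m ^ k
  m^n = trans (^-distribˡ-+-* m k (suc j)) (*-comm (m ^ k) (m * m ^ j))

-- finToFun lists the base m digits of i from the most significant one.
toℕ-finToFun : ∀ m n .{{_ : NonZero m}} (i : Fin (m ^ n)) (j : Fin n) →
  toℕ (finToFun {m} {n} i j) ≡ digit m (n ∸ suc (toℕ j)) (toℕ i)
toℕ-finToFun m (suc n) i zero = begin
  toℕ (proj₁ (remQuot {m} (m ^ n) i))       ≡⟨ m<n⇒m%n≡m (toℕ<n _) ⟨
  toℕ (proj₁ (remQuot {m} (m ^ n) i)) % m   ≡⟨ cong (_% m) (toℕ-quotient {m} (m ^ n) i) ⟩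
  digit m n (toℕ i)                         ∎
  where
  open ≡-Reasoning
  instance _ = m^n≢0 m n
toℕ-finToFun m (suc n) i (suc j) = begin
  toℕ (finToFun (proj₂ (remQuot {m} (m ^ n) i)) j)   ≡⟨ toℕ-finToFun m n _ j ⟩
  digit m k (toℕ (proj₂ (remQuot {m} (m ^ n) i)))
    ≡⟨ cong (digit m k) (toℕ-remainder {m} (m ^ n) i) ⟩
  digit m k (toℕ i % m ^ n)
    ≡⟨ digit-% m k (toℕ j) n (toℕ i) (sym (m∸n+n≡m (toℕ<n j))) ⟩
  digit m k (toℕ i)                                  ∎
  where
  open ≡-Reasoning
  k = n ∸ suc (toℕ j)
  instance _ = m^n≢0 m n

-- The number whose base (2 + g) digits, least significant first, are the
-- symbols; the zeros beyond the last digit stand for the blank part of the tape.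
encodeTape : ∀ {g} → List (Fin (2 + g)) → ℕ
encodeTape         []       = 0
encodeTape {g = g} (s ∷ ss) = toℕ s + encodeTape ss * (2 + g)

encode : ∀ {M} → Configuration M → ℕ
encode (config a ls s rs) = pair (toℕ a) (pair (encodeTape ls) (encodeTape (s ∷ rs)))

-- Here `s` is the symbol just written, and `L` and `R` stand for the cells strictly to the left and
-- right of it. In the result the right-hand number includes the newly scanned cell as its lowest
-- digit, as in `encode`.
shift : (g a s d L R : ℕ) → ℕ
shift g a s d L R = if d ≡ᵇ 0
  then pair a (pair (L / G) (L % G + (s + R * G) * G))
  else pair a (pair (s + L * G) R)
  where G = 2 + g

perform : (g i L R : ℕ) → ℕ
perform g i L R = shift g (i / (G * 2)) (i % (G * 2) / 2) (i % (G * 2) % 2) L R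
  where G = 2 + g

-- The entry for state `a` and symbol `s` has index `G * a + s` under `combine`. As `finToFun`
-- starts from the most significant of the `Q * G` digits, the position is counted from the other
-- end.
actionNumber : (q g t a s : ℕ) → ℕ
actionNumber q g t a s =
  digit (#Actions Q G) (Q * G ∸ suc (G * a + s)) ((t % #Tables Q G) {{#Tables≢0 q g}})
  where
  Q = 2 + q
  G = 2 + g

transition : (q g t a L R : ℕ) → ℕ
transition q g t a L R = perform g (actionNumber q g t a (R % G)) L (R / G)
  where G = 2 + g

advance : (q g t c : ℕ) → ℕ
advance q g t c = if fst c ≡ᵇ 0 then c else transition q g t (fst c) (fst (snd c)) (snd (snd c))

module _ (M : TuringMachine) where
  open TuringMachine M renaming (extraSymbols to g)

  private
    G = 2 + g

  -- The blank is digit 0, so the blank supplied by popping an empty list does not change the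
  -- number.
  encodeTape-pop : ∀ ls → let (l , ls′) = pop M ls in
    toℕ l + encodeTape ls′ * G ≡ encodeTape ls
  encodeTape-pop []       = refl
  encodeTape-pop (l ∷ ls) = refl

  encodeTape-% : ∀ s ss → encodeTape (s ∷ ss) % G ≡ toℕ s
  encodeTape-% s ss = remainder-unique (toℕ s) (encodeTape ss) G (toℕ<n s)

  encodeTape-/ : ∀ s ss → encodeTape (s ∷ ss) / G ≡ encodeTape ss
  encodeTape-/ s ss = quotient-unique (toℕ s) (encodeTape ss) G (toℕ<n s)

  -- A move to the right pushes a digit onto the left number. A move to the left splits off its
  -- lowest digit by division with remainder, and `encodeTape-pop` covers the empty left tape.
  encode-act : ∀ a s d ls rs → encode (act M (a , s , d) ls rs) ≡
    shift g (toℕ a) (toℕ s) (toℕ (fromDirection d)) (encodeTape ls) (encodeTape rs)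
  encode-act a s right ls rs =
    cong (λ R → pair (toℕ a) (pair (toℕ s + encodeTape ls * G) R)) (encodeTape-pop rs)
  encode-act a s left ls rs =
    let (l , ls′) = pop M ls
        N = (toℕ s + encodeTape rs * G) * G
    in cong₂ (λ L l → pair (toℕ a) (pair L (l + N)))
      (trans (sym (encodeTape-/ l ls′)) (cong (_/ G) (encodeTape-pop ls)))
      (trans (sym (encodeTape-% l ls′)) (cong (_% G) (encodeTape-pop ls)))

  encode-perform : ∀ (i : Fin (#Actions (2 + extraStates) G)) ls rs →
    encode (act M (toAction i) ls rs) ≡ perform g (toℕ i) (encodeTape ls) (encodeTape rs)
  encode-perform i ls rs =
    let (a , j) = remQuot {2 + extraStates} (G * 2) i
        (s , d) = remQuot {G} 2 j
        toℕ-j = toℕ-remainder {2 + extraStates} (G * 2) i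
        L = encodeTape ls
        R = encodeTape rs
    in begin
      encode (act M (a , s , toDirection d) ls rs)
        ≡⟨ encode-act a s (toDirection d) ls rs ⟩
      shift g (toℕ a) (toℕ s) (toℕ (fromDirection (toDirection d))) L R
        ≡⟨ cong (λ d → shift g (toℕ a) (toℕ s) (toℕ d) L R) (fromDirection-toDirection d) ⟩
      shift g (toℕ a) (toℕ s) (toℕ d) L R
        ≡⟨ cong₂ (λ s d → shift g (toℕ a) s d L R) (toℕ-quotient {G} 2 j) (toℕ-remainder {G} 2 j) ⟩
      shift g (toℕ a) (toℕ j / 2) (toℕ j % 2) L R
        ≡⟨ cong₂ (λ a j → shift g a (j / 2) (j % 2) L R) (toℕ-quotient {2 + extraStates} (G * 2) i) toℕ-j ⟩
      perform g (toℕ i) L R ∎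
    where
    open ≡-Reasoning
    fromDirection-toDirection : ∀ d → fromDirection (toDirection d) ≡ d
    fromDirection-toDirection zero       = refl
    fromDirection-toDirection (suc zero) = refl

toℕ-entry : ∀ Q G .{{_ : NonZero (#Actions Q G)}} .{{_ : NonZero (#Tables Q G)}}
  t (a : Fin Q) (s : Fin G) →
  toℕ (finToFun {#Actions Q G} {Q * G} (t mod #Tables Q G) (combine a s)) ≡
  digit (#Actions Q G) (Q * G ∸ suc (G * toℕ a + toℕ s)) (t % #Tables Q G)
toℕ-entry Q G t a s = trans
  (toℕ-finToFun (#Actions Q G) (Q * G) (t mod #Tables Q G) (combine a s))
  (cong₂ (λ k → digit (#Actions Q G) (Q * G ∸ suc k)) (toℕ-combine a s) (toℕ-fromℕ< _))

toℕ-actionNumber : ∀ q g t (a : Fin (2 + q)) (s : Fin (2 + g)) →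
  toℕ (finToFun {#Actions (2 + q) (2 + g)} {(2 + q) * (2 + g)}
        ((t mod #Tables (2 + q) (2 + g)) {{#Tables≢0 q g}}) (combine a s)) ≡
  actionNumber q g t (toℕ a) (toℕ s)
toℕ-actionNumber q g t a s = toℕ-entry (2 + q) (2 + g) {{_}} {{#Tables≢0 q g}} t a s

advance-pair : ∀ q g t a L R → advance q g t (pair a (pair L R)) ≡
  (if a ≡ᵇ 0 then pair a (pair L R) else transition q g t a L R)
advance-pair q g t a L R =
  let c = pair a (pair L R)
      snd≡ = snd-pair a (pair L R)
  in trans
  (cong₂ (λ L R → if fst c ≡ᵇ 0 then c else transition q g t (fst c) L R)
    (trans (cong fst snd≡) (fst-pair L R)) (trans (cong snd snd≡) (snd-pair L R)))
  (cong (λ a → if a ≡ᵇ 0 then c else transition q g t a L R) (fst-pair a (pair L R)))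

-- The halting state has number 0, so the test in `advance` agrees with the clause of `step` that
-- fixes halted configurations. In any other state the scanned symbol is the lowest digit of the
-- right number, and it selects a digit of the table number.
encode-step : ∀ q g t (c : Configuration (machine q g (table q g t))) →
  encode (step _ c) ≡ advance q g t (encode c)
encode-step q g t (config zero ls s rs) =
  sym (advance-pair q g t 0 (encodeTape ls) (encodeTape (s ∷ rs)))
encode-step q g t (config (suc a) ls s rs) = begin
  encode (act M (toAction i) ls rs)
    ≡⟨ encode-perform M i ls rs ⟩
  perform g (toℕ i) L (encodeTape rs)
    ≡⟨ cong (λ i → perform g i L (encodeTape rs)) (toℕ-actionNumber q g t (suc a) s) ⟩
  perform g (actionNumber q g t (suc (toℕ a)) (toℕ s)) L (encodeTape rs)
    ≡⟨ cong₂ (λ s rs → perform g (actionNumber q g t (suc (toℕ a)) s) L rs)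
         (encodeTape-% M s rs) (encodeTape-/ M s rs) ⟨
  transition q g t (suc (toℕ a)) L (encodeTape (s ∷ rs))
    ≡⟨ advance-pair q g t (suc (toℕ a)) L (encodeTape (s ∷ rs)) ⟨
  advance q g t (encode c) ∎
  where
  open ≡-Reasoning
  M = machine q g (table q g t)
  L = encodeTape ls
  i = finToFun {#Actions (2 + q) (2 + g)} {(2 + q) * (2 + g)}
        ((t mod #Tables (2 + q) (2 + g)) {{#Tables≢0 q g}}) (combine (suc a) s)
  c : Configuration M
  c = config (suc a) ls s rs

-- Recursiveness of the simulation

module _ {O : ℕ → Set} {answer : ∀ {n} → O n → Vec ℕ n → ℕ} where
  open Computability answer

  private variable
    n : ℕ
    q g t a s d i L R c : Vec ℕ n → ℕ

  shiftᶜ : Computable g → Computable a → Computable s → Computable d → Computable L → Computable R →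
    Computable (λ xs → shift (g xs) (a xs) (s xs) (d xs) (L xs) (R xs))
  shiftᶜ g a s d L R = if0ᶜ d
    (pairᶜ a (pairᶜ (divideᶜ L G _) (moduloᶜ L G _ +ᶜ (s +ᶜ R *ᶜ G) *ᶜ G)))
    (pairᶜ a (pairᶜ (s +ᶜ L *ᶜ G) R))
    where G = 1+ᶜ 1+ᶜ g

  performᶜ : Computable g → Computable i → Computable L → Computable R →
    Computable (λ xs → perform (g xs) (i xs) (L xs) (R xs))
  performᶜ g i L R = shiftᶜ g
    (divideᶜ i G*2 _) (divideᶜ (moduloᶜ i G*2 _) (constᶜ 2) _)
    (moduloᶜ (moduloᶜ i G*2 _) (constᶜ 2) _) L R
    where G*2 = (1+ᶜ 1+ᶜ g) *ᶜ constᶜ 2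

  digitᶜ : Computable a → (a≢0 : ∀ xs → NonZero (a xs)) → Computable i → Computable t →
    Computable (λ xs → digit (a xs) {{a≢0 xs}} (i xs) (t xs))
  digitᶜ {i = j} a a≢0 i t = moduloᶜ (divideᶜ t (a ^ᶜ i) (λ xs → m^n≢0 _ (j xs) {{a≢0 xs}})) a a≢0

  actionNumberᶜ : Computable q → Computable g → Computable t → Computable a → Computable s →
    Computable (λ xs → actionNumber (q xs) (g xs) (t xs) (a xs) (s xs))
  actionNumberᶜ {q = k} {g = l} q g t a s = digitᶜ #actions _
    (Q *ᶜ G ∸ᶜ (1+ᶜ (G *ᶜ a +ᶜ s)))
    (moduloᶜ t (#actions ^ᶜ (Q *ᶜ G)) (λ xs → #Tables≢0 (k xs) (l xs)))
    where
    Q = 1+ᶜ 1+ᶜ q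
    G = 1+ᶜ 1+ᶜ g
    #actions = Q *ᶜ (G *ᶜ constᶜ 2)

  transitionᶜ : Computable q → Computable g → Computable t → Computable a → Computable L → Computable R →
    Computable (λ xs → transition (q xs) (g xs) (t xs) (a xs) (L xs) (R xs))
  transitionᶜ q g t a L R =
    performᶜ g (actionNumberᶜ q g t a (moduloᶜ R (1+ᶜ 1+ᶜ g) _)) L (divideᶜ R (1+ᶜ 1+ᶜ g) _)

  advanceᶜ : Computable q → Computable g → Computable t → Computable c →
    Computable (λ xs → advance (q xs) (g xs) (t xs) (c xs))
  advanceᶜ q g t c =
    if0ᶜ (fstᶜ c) c (transitionᶜ q g t (fstᶜ c) (fstᶜ (sndᶜ c)) (sndᶜ (sndᶜ c)))

  marksᶜ : Computable {2} λ { (x ∷ g ∷ []) → encodeTape {g} (replicate x (suc zero)) }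
  marksᶜ = precᶜ (constᶜ 0) (λ { (g ∷ []) → refl })
    (1+ᶜ (varᶜ 1F *ᶜ (1+ᶜ 1+ᶜ varᶜ 2F))) (λ { k (g ∷ []) → refl })

  runᶜ : Computable {5} λ { (n ∷ x ∷ q ∷ g ∷ t ∷ []) → encode (run (machine q g (table q g t)) x n) }
  runᶜ = precᶜ
    -- State 1 is initial, 0 is the empty tape to the left, and the marks include the scanned cell.
    (pairᶜ (constᶜ 1) (pairᶜ (constᶜ 0) (marksᶜ ∘ᶜ (varᶜ 0F ∷ᶜ [ varᶜ 2F ]ᶜ))))
    -- `start` pops the scanned cell off the marks, which yields a blank when `x` is 0; the number
    -- is the same.
    (λ { (x ∷ q ∷ g ∷ t ∷ []) → cong (λ R → pair 1 (pair 0 R))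
         (sym (encodeTape-pop (machine q g (table q g t)) (replicate x (suc zero)))) })
    (advanceᶜ (varᶜ 3F) (varᶜ 4F) (varᶜ 5F) (varᶜ 1F))
    (λ { k (x ∷ q ∷ g ∷ t ∷ []) → sym (encode-step q g t (run (machine q g (table q g t)) x k)) })

-- Constructibility of the coefficients

step-halted : ∀ M c → Configuration.state c ≡ zero → step M c ≡ c
step-halted M (config zero _ _ _) refl = refl

-- Halted configurations are fixed by `step`, so having halted by step `n` can be read off the state
-- at step `n` alone.
haltsIn-mono : ∀ M x {m n} → m ≤ n → HaltsIn M x m → HaltsIn M x n
haltsIn-mono M x m≤n h = go (≤⇒≤′ m≤n)
  where
  go : ∀ {n} → _ ≤′ n → HaltsIn M x n
  go (≤′-reflexive refl) = h
  go (≤′-step m≤′n)      = trans (cong Configuration.state (step-halted M _ (go m≤′n))) (go m≤′n)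

coeff-halted : ∀ P x n → HaltedBy P x n → coeff P x n ≡ n !
coeff-halted P x n h = cong (if_then n ! else 0) (dec-true (haltedBy? P x n) h)

coeff-running : ∀ P x n → ¬ HaltedBy P x n → coeff P x n ≡ 0
coeff-running P x n ¬h = cong (if_then n ! else 0) (dec-false (haltedBy? P x n) ¬h)

if-toℕ : ∀ {k} {A : Set} {x y z : A} (a : Fin (suc k)) →
  (a ≡ zero → x ≡ z) → (a ≢ zero → y ≡ z) → (if toℕ a ≡ᵇ 0 then x else y) ≡ z
if-toℕ zero    x≡z y≡z = x≡z refl
if-toℕ (suc a) x≡z y≡z = y≡z λ ()

coeff-state : ∀ P x n →
  (if fst (encode (run (decode P) x n)) ≡ᵇ 0 then n ! else 0) ≡ coeff P x n
coeff-state P x n = trans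
  (cong (λ a → if a ≡ᵇ 0 then n ! else 0) (fst-pair (toℕ (Configuration.state (run (decode P) x n))) _))
  (if-toℕ (Configuration.state (run (decode P) x n))
    (λ h → sym (coeff-halted P x n (n , ≤-refl , h)))
    (λ ¬h → sym (coeff-running P x n λ (m , m≤n , h) → ¬h (haltsIn-mono (decode P) x m≤n h))))

coeff-effective : EffectivelyConstructible coeff
coeff-effective = let (c , c⇓) = coeffᶜ in c , λ P x n → c⇓ (P ∷ x ∷ n ∷ [])
  where
  open Computability noAnswer
  coeffᶜ : Computable {3} λ { (P ∷ x ∷ n ∷ []) → coeff P x n }
  coeffᶜ = ext (λ { (P ∷ x ∷ n ∷ []) → coeff-state P x n })
    -- `P` is taken apart into `q`, `g` and `t` as in `decode`; the state is the first component of
    -- the encoded configuration.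
    (if0ᶜ (fstᶜ (runᶜ ∘ᶜ (varᶜ 2F ∷ᶜ varᶜ 1F ∷ᶜ
             fstᶜ (varᶜ 0F) ∷ᶜ fstᶜ (sndᶜ (varᶜ 0F)) ∷ᶜ [ sndᶜ (sndᶜ (varᶜ 0F)) ]ᶜ)))
          (varᶜ 2F !ᶜ) (constᶜ 0))

-- Convergence

-- The value of `+ n ℚ./ 1` in lowest terms. The division normalises by a gcd that is stuck for a
-- variable `n`, whereas sums, products and comparisons see the explicit numerator and denominator
-- here.
integral : ℕ → ℚ
integral n = mkℚ (+ n) 0 (coprime-sym (1-coprimeTo n))

/1≡integral : ∀ n → + n ℚ./ 1 ≡ integral n
/1≡integral n = ℚ.↥p/↧p≡p (integral n)

/1-*-homo : ∀ m n → + (m * n) ℚ./ 1 ≡ (+ m ℚ./ 1) ℚ.* (+ n ℚ./ 1)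
/1-*-homo m n = begin
  + (m * n) ℚ./ 1                 ≡⟨ cong (ℚ._/ 1) (ℤ.pos-* m n) ⟩
  integral m ℚ.* integral n       ≡⟨ cong₂ ℚ._*_ (/1≡integral m) (/1≡integral n) ⟨
  (+ m ℚ./ 1) ℚ.* (+ n ℚ./ 1)     ∎
  where open ≡-Reasoning

/1-cancel-≤ : ∀ {m n} → + m ℚ./ 1 ℚ.≤ + n ℚ./ 1 → m ≤ n
/1-cancel-≤ {m} {n} m≤n = ℤ.drop‿+≤+ (subst₂ ℤ._≤_ (ℤ.*-identityʳ _) (ℤ.*-identityʳ _)
  (ℚ.drop-*≤* (subst₂ ℚ._≤_ (/1≡integral m) (/1≡integral n) m≤n)))

/1-nonNegative : ∀ n → ℚ.NonNegative (+ n ℚ./ 1)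
/1-nonNegative n = subst ℚ.NonNegative (sym (/1≡integral n)) _

≤-numerator : ∀ p → p ℚ.≤ + ℤ.∣ ℚ.↥ p ∣ ℚ./ 1
≤-numerator p@(mkℚ n d _) = subst (p ℚ.≤_) (sym (/1≡integral ℤ.∣ n ∣)) (ℚ.*≤* (begin
  n ℤ.* + 1                  ≡⟨ ℤ.*-identityʳ n ⟩
  n                          ≤⟨ i≤+∣i∣ n ⟩
  + ℤ.∣ n ∣                  ≤⟨ ℤ.+≤+ (m≤m*n ℤ.∣ n ∣ (suc d)) ⟩
  + (ℤ.∣ n ∣ * suc d)        ≡⟨ ℤ.pos-* ℤ.∣ n ∣ (suc d) ⟩
  + ℤ.∣ n ∣ ℤ.* + suc d      ∎))
  where
  open ℤ.≤-Reasoning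
  i≤+∣i∣ : ∀ i → i ℤ.≤ + ℤ.∣ i ∣
  i≤+∣i∣ (+ n)       = ℤ.≤-refl
  i≤+∣i∣ (ℤ.-[1+ n ]) = ℤ.-≤+

-- The numerator of the positive rational `1/p` bounds `1/p`, because its denominator is at least 1.
archimedean : ∀ p → 0ℚ ℚ.< p → ∃[ M ] 1ℚ ℚ.≤ (+ M ℚ./ 1) ℚ.* p
archimedean p 0<p = ℤ.∣ ℚ.↥ (ℚ.1/ p) ∣ , (begin
  1ℚ                                        ≡⟨ ℚ.*-inverseˡ p ⟨
  ℚ.1/ p ℚ.* p                              ≤⟨ ℚ.*-monoʳ-≤-nonNeg p (≤-numerator (ℚ.1/ p)) ⟩
  (+ ℤ.∣ ℚ.↥ (ℚ.1/ p) ∣ ℚ./ 1) ℚ.* p        ∎)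
  where
  open ℚ.≤-Reasoning
  instance
    _ = ℚ.positive 0<p
    _ = ℚ.pos⇒nonZero p
    _ = ℚ.pos⇒nonNeg p

-- Up to `n = M` the power is at most `M ^ M`; after that each step multiplies the left side by `M`
-- and the right side by something larger. The case `M = 0` is separate because powers are monotone
-- in the exponent only for a nonzero base.
^≤!*^ : ∀ M n → M ^ n ≤ n ! * M ^ M
^≤!*^ M n with n ≤? M
^≤!*^ zero    zero    | yes n≤M = ≤-refl
^≤!*^ (suc M) n       | yes n≤M = ≤-trans (^-monoʳ-≤ (suc M) n≤M) (m≤n*m _ (n !) {{n !≢0}})
^≤!*^ M       zero    | no n≰M = contradiction z≤n n≰M
^≤!*^ M       (suc n) | no n≰M = begin
  M * M ^ n                  ≤⟨ *-mono-≤ (<⇒≤ (≰⇒> n≰M)) (^≤!*^ M n) ⟩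
  suc n * (n ! * M ^ M)      ≡⟨ *-assoc (suc n) (n !) (M ^ M) ⟨
  suc n ! * M ^ M            ∎
  where open ≤-Reasoning

-- By `^≤!*^`, `4 * M ^ n` is at most `n ! * B`, so the inequality would give `n ! ≤ B` after
-- cancelling `n !`. This fails because `B < n` and `n ≤ n !`.
factorial²-dominates : ∀ M N → ∃[ n ] N ≤ n × ¬ (n ! * n ! ≤ 4 * M ^ n)
factorial²-dominates M N = n , m≤n⇒m≤1+n (m≤m+n N B) , λ n!²≤ → <⇒≱ (s≤s (m≤n+m B N)) (begin
  n       ≤⟨ m≤m*n n ((N + B) !) {{(N + B) !≢0}} ⟩
  n !     ≤⟨ *-cancelˡ-≤ (n !) {{n !≢0}} (begin
               n ! * n !             ≤⟨ n!²≤ ⟩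
               4 * M ^ n             ≤⟨ *-monoʳ-≤ 4 (^≤!*^ M n) ⟩
               4 * (n ! * M ^ M)     ≡⟨ *-assoc 4 (n !) (M ^ M) ⟨
               4 * n ! * M ^ M       ≡⟨ cong (_* M ^ M) (*-comm 4 (n !)) ⟩
               n ! * 4 * M ^ M       ≡⟨ *-assoc (n !) 4 (M ^ M) ⟩
               n ! * B               ∎) ⟩
  B       ∎)
  where
  open ≤-Reasoning
  B = 4 * M ^ M
  n = suc (N + B)

-- Estimates for the squared modulus

*-mono-≤-nonNeg : ∀ {p q r s} → ℚ.NonNegative p → ℚ.NonNegative r →
  p ℚ.≤ q → r ℚ.≤ s → p ℚ.* r ℚ.≤ q ℚ.* s
*-mono-≤-nonNeg {p} {q} {r} {s} 0≤p 0≤r p≤q r≤s = ℚ.≤-trans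
  (ℚ.*-monoʳ-≤-nonNeg r {{0≤r}} p≤q)
  (ℚ.*-monoˡ-≤-nonNeg q {{ℚ.nonNegative (ℚ.≤-trans (ℚ.nonNegative⁻¹ p {{0≤p}}) p≤q)}} r≤s)

∣p∣*∣p∣≡p*p : ∀ p → ℚ.∣ p ∣ ℚ.* ℚ.∣ p ∣ ≡ p ℚ.* p
∣p∣*∣p∣≡p*p p with ℚ.∣p∣≡p∨∣p∣≡-p p
... | inj₁ eq rewrite eq = refl
... | inj₂ eq rewrite eq = solve 1 (λ p → :- p :* :- p := p :* p) refl p
  where open +-*-Solver

0≤p*p : ∀ p → 0ℚ ℚ.≤ p ℚ.* p
0≤p*p p = subst (0ℚ ℚ.≤_) (∣p∣*∣p∣≡p*p p)
  (ℚ.nonNegative⁻¹ _ {{ℚ.nonNeg*nonNeg⇒nonNeg ℚ.∣ p ∣ {{ℚ.∣-∣-nonNeg p}} ℚ.∣ p ∣ {{ℚ.∣-∣-nonNeg p}}}})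

-- The estimates are carried out on the rational approximations of one index `k`, where algebraic
-- identities hold exactly.
∣_∣²ₖ : ℂ → ℕ → ℚ
∣ z ∣²ₖ k = seq ∣ z ∣² k

0≤∣z∣²ₖ : ∀ z k → 0ℚ ℚ.≤ ∣ z ∣²ₖ k
0≤∣z∣²ₖ z k = ℚ.+-mono-≤ (0≤p*p (seq (re z) k)) (0≤p*p (seq (im z) k))

-- The two-square identity of Brahmagupta and Fibonacci.
∣*∣² : ∀ z w k → ∣ z Defs.* w ∣²ₖ k ≡ ∣ z ∣²ₖ k ℚ.* ∣ w ∣²ₖ k
∣*∣² z w k = solve 4 (λ a b c d →
    (a :* c :- b :* d) :* (a :* c :- b :* d) :+ (a :* d :+ b :* c) :* (a :* d :+ b :* c)
    := (a :* a :+ b :* b) :* (c :* c :+ d :* d)) refl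
  (seq (re z) k) (seq (im z) k) (seq (re w) k) (seq (im w) k)
  where open +-*-Solver

∣fromℕ∣² : ∀ m k → ∣ fromℕ m ∣²ₖ k ≡ + (m * m) ℚ./ 1
∣fromℕ∣² m k = trans (ℚ.+-identityʳ _) (sym (/1-*-homo m m))

-- The bound `1/M` on the squared modulus is kept multiplied out, so that taking powers involves no
-- division.
≤-powers : ∀ M z k → 1ℚ ℚ.≤ (+ M ℚ./ 1) ℚ.* ∣ z ∣²ₖ k →
  ∀ n → 1ℚ ℚ.≤ (+ (M ^ n) ℚ./ 1) ℚ.* ∣ z Defs.^ n ∣²ₖ k
≤-powers M z k 1≤ zero    = ℚ.≤-refl
≤-powers M z k 1≤ (suc n) = begin
  1ℚ ℚ.* 1ℚ                                   ≤⟨ *-mono-≤-nonNeg _ _ 1≤ (≤-powers M z k 1≤ n) ⟩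
  (M′ ℚ.* ∣ z ∣²ₖ k) ℚ.* (N′ ℚ.* ∣ z Defs.^ n ∣²ₖ k)
    ≡⟨ solve 4 (λ a b c d → (a :* b) :* (c :* d) := (a :* c) :* (b :* d)) refl M′ (∣ z ∣²ₖ k) N′ _ ⟩
  (M′ ℚ.* N′) ℚ.* (∣ z ∣²ₖ k ℚ.* ∣ z Defs.^ n ∣²ₖ k)
    ≡⟨ cong₂ ℚ._*_ (/1-*-homo M (M ^ n)) (∣*∣² z (z Defs.^ n) k) ⟨
  (+ (M ^ suc n) ℚ./ 1) ℚ.* ∣ z Defs.^ suc n ∣²ₖ k ∎
  where
  open ℚ.≤-Reasoning
  open +-*-Solver
  M′ = + M ℚ./ 1
  N′ = + (M ^ n) ℚ./ 1

-- The parallelogram law for `s - w` and `s + t - w`, whose difference is `t` up to sign, with the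
-- squared modulus of their sum `v` dropped. It replaces the triangle inequality, which would
-- involve square roots.
∣difference∣² : ∀ s t w k → ∣ t ∣²ₖ k ℚ.≤
  (+ 2 ℚ./ 1) ℚ.* (∣ s Defs.- w ∣²ₖ k ℚ.+ ∣ (s Defs.+ t) Defs.- w ∣²ₖ k)
∣difference∣² s t w k = begin
  ∣ t ∣²ₖ k                                                  ≡⟨ ℚ.+-identityʳ (∣ t ∣²ₖ k) ⟨
  ∣ t ∣²ₖ k ℚ.+ 0ℚ
    ≤⟨ ℚ.+-monoʳ-≤ (∣ t ∣²ₖ k) (0≤∣z∣²ₖ v k) ⟩
  ∣ t ∣²ₖ k ℚ.+ ∣ v ∣²ₖ k                                    ≡⟨ parallelogram ⟩
  (+ 2 ℚ./ 1) ℚ.* (∣ s Defs.- w ∣²ₖ k ℚ.+ ∣ (s Defs.+ t) Defs.- w ∣²ₖ k)  ∎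
  where
  open ℚ.≤-Reasoning
  open +-*-Solver
  v = (s Defs.- w) Defs.+ ((s Defs.+ t) Defs.- w)
  parallelogram = solve 6 (λ s s′ t t′ w w′ →
    (t :* t :+ t′ :* t′) :+
      (((s :- w) :+ ((s :+ t) :- w)) :* ((s :- w) :+ ((s :+ t) :- w)) :+
       ((s′ :- w′) :+ ((s′ :+ t′) :- w′)) :* ((s′ :- w′) :+ ((s′ :+ t′) :- w′)))
    := con (+ 2 ℚ./ 1) :*
      (((s :- w) :* (s :- w) :+ (s′ :- w′) :* (s′ :- w′)) :+
       (((s :+ t) :- w) :* ((s :+ t) :- w) :+ ((s′ :+ t′) :- w′) :* ((s′ :+ t′) :- w′)))) refl
    (seq (re s) k) (seq (im s) k) (seq (re t) k) (seq (im t) k) (seq (re w) k) (seq (im w) k)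

-- A term is the difference of two consecutive partial sums. Taking `ε = 1` puts both within 1 of
-- the limit, and `∣difference∣²` gives `2 * (1 + 1)`. The index `K` depends on `n`, as an
-- inequality of reals only concerns late approximations.
bounded-terms : ∀ a z → a ConvergesAt z →
  ∃[ N ] ∀ n → N ≤ n → ∃[ K ] ∀ k → K ≤ k → ∣ a n Defs.* z Defs.^ n ∣²ₖ k ℚ.≤ + 4 ℚ./ 1
bounded-terms a z (w , s⟶w) =
  let (N , near) = s⟶w (fromℚ 1ℚ) (1ℚ , ℚ.positive⁻¹ 1ℚ , 0 , λ _ _ → ℚ.≤-refl)
  in N , λ n N≤n →
    let (δ , 0<δ , K , p) = near n N≤n
        (δ′ , 0<δ′ , K′ , p′) = near (suc n) (m≤n⇒m≤1+n N≤n)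
    in K ⊔ K′ , λ k K⊔K′≤k → ℚ.≤-trans (∣difference∣² (s n) (a n Defs.* z Defs.^ n) w k)
      (ℚ.*-monoˡ-≤-nonNeg (+ 2 ℚ./ 1) (ℚ.+-mono-≤
        {∣ s n Defs.- w ∣²ₖ k} {1ℚ} {∣ s (suc n) Defs.- w ∣²ₖ k} {1ℚ}
        (drop _ 0<δ (p k (m⊔n≤o⇒m≤o K K′ K⊔K′≤k))) (drop _ 0<δ′ (p′ k (m⊔n≤o⇒n≤o K K′ K⊔K′≤k)))))
  where
  s = partialSum a z
  drop : ∀ p {δ q} → 0ℚ ℚ.< δ → p ℚ.+ δ ℚ.≤ q → p ℚ.≤ q
  drop p {δ} 0<δ p+δ≤q = ℚ.≤-trans
    (subst (ℚ._≤ p ℚ.+ δ) (ℚ.+-identityʳ p) (ℚ.+-monoʳ-≤ p (ℚ.<⇒≤ 0<δ))) p+δ≤q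

-- First `M` is fixed by `η`, then `n` by `M`, and only then the index `k`, late enough for both the
-- lower bound on `z` and the upper bound on the `n`-th term. At `k` these combine to the inequality
-- that `factorial²-dominates` refutes.
factorial-diverges : ∀ a z m → (∀ n → m ≤ n → a n ≡ fromℕ (n !)) → a ConvergesAt z →
  ∀ η → 0ℚ ℚ.< η → ∀ K → ¬ (∀ k → K ≤ k → η ℚ.≤ ∣ z ∣²ₖ k)
factorial-diverges a z m a≡! conv η 0<η K η≤ =
  let (N , terms) = bounded-terms a z conv
      (M , 1≤Mη) = archimedean η 0<η
      (n , m⊔N≤n , n!²≰) = factorial²-dominates M (m ⊔ N)
      (K′ , bound) = terms n (m⊔n≤o⇒n≤o m N m⊔N≤n)
      k = K ⊔ K′
      n!² = + (n ! * n !) ℚ./ 1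
      Mⁿ = + (M ^ n) ℚ./ 1
      ∣zⁿ∣² = ∣ z Defs.^ n ∣²ₖ k
      1≤M∣z∣² = ℚ.≤-trans 1≤Mη
        (ℚ.*-monoˡ-≤-nonNeg (+ M ℚ./ 1) {{/1-nonNegative M}} (η≤ k (m≤m⊔n K K′)))
  in n!²≰ (/1-cancel-≤ (begin
    n!²                                       ≡⟨ ℚ.*-identityʳ n!² ⟨
    n!² ℚ.* 1ℚ
      ≤⟨ ℚ.*-monoˡ-≤-nonNeg n!² {{/1-nonNegative (n ! * n !)}}
                                                   (≤-powers M z k 1≤M∣z∣² n) ⟩
    n!² ℚ.* (Mⁿ ℚ.* ∣zⁿ∣²)
      ≡⟨ solve 3 (λ a b c → a :* (b :* c) := (a :* c) :* b) refl n!² Mⁿ ∣zⁿ∣² ⟩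
    n!² ℚ.* ∣zⁿ∣² ℚ.* Mⁿ                      ≡⟨ cong (λ c → c ℚ.* ∣zⁿ∣² ℚ.* Mⁿ) (∣fromℕ∣² (n !) k) ⟨
    ∣ fromℕ (n !) ∣²ₖ k ℚ.* ∣zⁿ∣² ℚ.* Mⁿ      ≡⟨ cong (λ c → ∣ c ∣²ₖ k ℚ.* ∣zⁿ∣² ℚ.* Mⁿ)
                                                   (a≡! n (m⊔n≤o⇒m≤o m N m⊔N≤n)) ⟨
    ∣ a n ∣²ₖ k ℚ.* ∣zⁿ∣² ℚ.* Mⁿ              ≡⟨ cong (ℚ._* Mⁿ) (∣*∣² (a n) (z Defs.^ n) k) ⟨
    ∣ a n Defs.* z Defs.^ n ∣²ₖ k ℚ.* Mⁿ
      ≤⟨ ℚ.*-monoʳ-≤-nonNeg Mⁿ {{/1-nonNegative (M ^ n)}} (bound k (m≤n⊔m K K′)) ⟩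
    (+ 4 ℚ./ 1) ℚ.* Mⁿ                        ≡⟨ /1-*-homo 4 (M ^ n) ⟨
    + (4 * M ^ n) ℚ./ 1                       ∎))
  where
  open ℚ.≤-Reasoning
  open +-*-Solver

-- The order on ℝ is undecidable, but comparing one late term with 2ε/3 suffices.
small-or-apart : ∀ x ε → 0ℚ ℚ.< ε →
  (∃[ N ] ∀ n → N ≤ n → ℚ.∣ seq x n ℚ.- 0ℚ ∣ ℚ.< ε) ⊎
  (∃[ η ] 0ℚ ℚ.< η × ∃[ N ] ∀ n → N ≤ n → η ℚ.≤ ℚ.∣ seq x n ∣)
small-or-apart x ε 0<ε = split (ℚ.∣ b ∣ ℚ.<? η ℚ.+ η)
  where
  open ℚ.≤-Reasoning
  open +-*-Solver
  ⅓ = + 1 ℚ./ 3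
  η = ⅓ ℚ.* ε
  0<η : 0ℚ ℚ.< η
  0<η = ℚ.positive⁻¹ η {{ℚ.pos*pos⇒pos ⅓ ε {{ℚ.positive 0<ε}}}}
  N = proj₁ (cauchy x η 0<η)
  b = seq x N
  close : ∀ m n → N ≤ m → N ≤ n → ℚ.∣ seq x m ℚ.- seq x n ∣ ℚ.< η
  close = proj₂ (cauchy x η 0<η)
  split : Dec (ℚ.∣ b ∣ ℚ.< η ℚ.+ η) → _
  split (yes ∣b∣<2η) = inj₁ (N , λ n N≤n → let a = seq x n in begin-strict
    ℚ.∣ a ℚ.- 0ℚ ∣
      ≡⟨ cong ℚ.∣_∣ (solve 2 (λ a b → a :- con 0ℚ := (a :- b) :+ b) refl a b) ⟩
    ℚ.∣ (a ℚ.- b) ℚ.+ b ∣         ≤⟨ ℚ.∣p+q∣≤∣p∣+∣q∣ (a ℚ.- b) b ⟩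
    ℚ.∣ a ℚ.- b ∣ ℚ.+ ℚ.∣ b ∣     <⟨ ℚ.+-mono-< (close n N N≤n ≤-refl) ∣b∣<2η ⟩
    η ℚ.+ (η ℚ.+ η)
      ≡⟨ solve 1 (λ ε → con ⅓ :* ε :+ (con ⅓ :* ε :+ con ⅓ :* ε) := ε) refl ε ⟩
    ε                             ∎)
  split (no ∣b∣≮2η) = inj₂ (η , 0<η , N , λ n N≤n → let a = seq x n in begin
    η                                           ≡⟨ solve 1 (λ η → η := (η :+ η) :- η) refl η ⟩
    (η ℚ.+ η) ℚ.- η
      ≤⟨ ℚ.+-mono-≤ (ℚ.≮⇒≥ ∣b∣≮2η) (ℚ.neg-antimono-≤ (ℚ.<⇒≤ (close N n ≤-refl N≤n))) ⟩
    ℚ.∣ b ∣ ℚ.- ℚ.∣ b ℚ.- a ∣                   ≡⟨ cong (λ c → ℚ.∣ c ∣ ℚ.- ℚ.∣ b ℚ.- a ∣)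
                                                     (solve 2 (λ a b → b := (b :- a) :+ a) refl a b) ⟩
    ℚ.∣ (b ℚ.- a) ℚ.+ a ∣ ℚ.- ℚ.∣ b ℚ.- a ∣
      ≤⟨ ℚ.+-monoˡ-≤ (ℚ.- ℚ.∣ b ℚ.- a ∣) (ℚ.∣p+q∣≤∣p∣+∣q∣ (b ℚ.- a) a) ⟩
    (ℚ.∣ b ℚ.- a ∣ ℚ.+ ℚ.∣ a ∣) ℚ.- ℚ.∣ b ℚ.- a ∣
      ≡⟨ solve 2 (λ a b → (b :+ a) :- b := a) refl ℚ.∣ a ∣ ℚ.∣ b ℚ.- a ∣ ⟩
    ℚ.∣ a ∣                                     ∎)

-- For each coordinate and each `ε`, `small-or-apart` offers the desired bound or a positive `η`
-- below the absolute value; the latter keeps the squared modulus above `η * η`, against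
-- `factorial-diverges`.
factorial-converges⇒≈0 : ∀ a z m → (∀ n → m ≤ n → a n ≡ fromℕ (n !)) → a ConvergesAt z → z ≈ 0ℂ
factorial-converges⇒≈0 a z m a≡! conv = null (re z) re²≤ , null (im z) im²≤
  where
  re²≤ : ∀ k → seq (re z) k ℚ.* seq (re z) k ℚ.≤ ∣ z ∣²ₖ k
  re²≤ k = subst (ℚ._≤ ∣ z ∣²ₖ k) (ℚ.+-identityʳ x²) (ℚ.+-monoʳ-≤ x² (0≤p*p (seq (im z) k)))
    where x² = seq (re z) k ℚ.* seq (re z) k
  im²≤ : ∀ k → seq (im z) k ℚ.* seq (im z) k ℚ.≤ ∣ z ∣²ₖ k
  im²≤ k = subst (ℚ._≤ ∣ z ∣²ₖ k) (ℚ.+-identityˡ y²) (ℚ.+-monoˡ-≤ y² (0≤p*p (seq (re z) k)))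
    where y² = seq (im z) k ℚ.* seq (im z) k
  null : ∀ x → (∀ k → seq x k ℚ.* seq x k ℚ.≤ ∣ z ∣²ₖ k) → x ≈ℝ 0ℝ
  null x x²≤ ε 0<ε with small-or-apart x ε 0<ε
  ... | inj₁ small = small
  ... | inj₂ (η , 0<η , N , η≤) = ⊥-elim (factorial-diverges a z m a≡! conv (η ℚ.* η)
    (ℚ.positive⁻¹ _ {{ℚ.pos*pos⇒pos η {{ℚ.positive 0<η}} η {{ℚ.positive 0<η}}}}) N
    (λ k N≤k → ℚ.≤-trans
      (subst (η ℚ.* η ℚ.≤_) (∣p∣*∣p∣≡p*p (seq x k)) (*-mono-≤-nonNeg 0≤η 0≤η (η≤ k N≤k) (η≤ k N≤k)))
      (x²≤ k)))
    where
    0≤η : ℚ.NonNegative η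
    0≤η = ℚ.nonNegative (ℚ.<⇒≤ 0<η)

-- Stated for approximations, since propositional equality of complex numbers would also compare the
-- Cauchy proofs.
partialSum-zero : ∀ a z → (∀ n → a n ≡ 0ℂ) → ∀ n k →
  seq (re (partialSum a z n)) k ≡ 0ℚ × seq (im (partialSum a z n)) k ≡ 0ℚ
partialSum-zero a z a≡0 zero    k = refl , refl
partialSum-zero a z a≡0 (suc n) k rewrite a≡0 n =
  let (re≡0 , im≡0) = partialSum-zero a z a≡0 n k
      x = seq (re (z Defs.^ n)) k
      y = seq (im (z Defs.^ n)) k
  in trans (cong (ℚ._+ (0ℚ ℚ.* x ℚ.- 0ℚ ℚ.* y)) re≡0)
       (solve 2 (λ x y → con 0ℚ :+ (con 0ℚ :* x :- con 0ℚ :* y) := con 0ℚ) refl x y) ,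
     trans (cong (ℚ._+ (0ℚ ℚ.* y ℚ.+ 0ℚ ℚ.* x)) im≡0)
       (solve 2 (λ x y → con 0ℚ :+ (con 0ℚ :* y :+ con 0ℚ :* x) := con 0ℚ) refl x y)
  where open +-*-Solver

zero-converges : ∀ a z → (∀ n → a n ≡ 0ℂ) → a ConvergesAt z
zero-converges a z a≡0 = 0ℂ , λ ε (δ , 0<δ , N , δ≤ε) → 0 , λ n _ →
  -- If `δ` separates 0 from `ε`, then `δ * δ` separates 0 from `ε * ε`, from the same index on.
  δ ℚ.* δ , ℚ.positive⁻¹ _ {{ℚ.pos*pos⇒pos δ {{ℚ.positive 0<δ}} δ {{ℚ.positive 0<δ}}}} , N , λ k N≤k →
    let (re≡0 , im≡0) = partialSum-zero a z a≡0 n k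
        0≤δ = ℚ.nonNegative (ℚ.<⇒≤ 0<δ)
        δ≤εₖ = subst (ℚ._≤ seq ε k) (ℚ.+-identityˡ δ) (δ≤ε k N≤k)
    in begin
      ∣ partialSum a z n Defs.- 0ℂ ∣²ₖ k ℚ.+ δ ℚ.* δ
        ≡⟨ cong₂ (λ x y → (x ℚ.- 0ℚ) ℚ.* (x ℚ.- 0ℚ) ℚ.+ (y ℚ.- 0ℚ) ℚ.* (y ℚ.- 0ℚ) ℚ.+ δ ℚ.* δ) re≡0 im≡0 ⟩
      0ℚ ℚ.+ δ ℚ.* δ           ≡⟨ ℚ.+-identityˡ _ ⟩
      δ ℚ.* δ                  ≤⟨ *-mono-≤-nonNeg 0≤δ 0≤δ δ≤εₖ δ≤εₖ ⟩
      seq ε k ℚ.* seq ε k      ∎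
  where open ℚ.≤-Reasoning

-- Equivalence with the Halting Problem

1≉0 : 1ℂ ≉ 0ℂ
1≉0 (1≈0 , _) = let (N , <1) = 1≈0 1ℚ (ℚ.positive⁻¹ 1ℚ) in ℚ.<-irrefl refl (<1 N ≤-refl)

-- Halting makes every coefficient from some index on a factorial, which forces `z ≈ 0ℂ`. Without
-- halting the series is zero, and the point 1 serves as witness.
converges⇔¬halts : ∀ P x → ConvergesSomewhere P x ⇔ (¬ Halts P x)
converges⇔¬halts P x = mk⇔
  (λ (z , z≉0 , conv) (m , (k , k≤m , halted)) → z≉0 (factorial-converges⇒≈0 (S P x) z m
    (λ n m≤n → cong fromℕ (coeff-halted P x n (k , ≤-trans k≤m m≤n , halted))) conv))
  (λ ¬halts → 1ℂ , 1≉0 , zero-converges (S P x) 1ℂ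
    (λ n → cong fromℕ (coeff-running P x n (λ halted → ¬halts (n , halted)))))

-- The reduction asks the oracle once and flips its answer. Covering is assumed only up to double
-- negation, which is what an equivalence with a negated statement provides constructively.
complement-≤ᵀ : ∀ {A B : DecisionProblem} →
  (∀ P x → A P x → ¬ B P x) → (∀ P x → ¬ A P x → ¬ ¬ B P x) → A ≤ᵀ B
complement-≤ᵀ disjoint covering χ χ-B =
  (λ P x → 1 ∸ χ P x) ,
  (λ P x → (λ a → cong (1 ∸_) (proj₂ (χ-B P x) (disjoint P x a))) ,
           -- The double negation disappears because the oracle's answer is a number, and equality
           -- of numbers is decidable.
           (λ ¬a → cong (1 ∸_) (decidable-stable (χ P x ≟ 1)
             (λ χ≢1 → covering P x ¬a (λ b → χ≢1 (proj₁ (χ-B P x) b)))))) ,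
  (let (c , c⇓) = complement in c , λ P x → c⇓ (P ∷ x ∷ []))
  where
  open Computability (answerBy χ)
  open Evaluation (answerBy χ) using (query⇓)
  complement : Computable {2} λ { (P ∷ x ∷ []) → 1 ∸ χ P x }
  complement = ext (λ { (P ∷ x ∷ []) → refl }) (constᶜ 1 ∸ᶜ (query oracle , λ _ → query⇓))

corollary1 : EffectivelyConstructible coeff
    × (∀ P x → (∃[ z ] (z ≉ 0ℂ × S P x ConvergesAt z)) ⇔ (¬ Halts P x))
    × ConvergesSomewhere ≡ᵀ Halts
corollary1 = coeff-effective , converges⇔¬halts ,
  complement-≤ᵀ
    (λ P x → to (converges⇔¬halts P x))
    (λ P x ¬conv ¬halts → ¬conv (from (converges⇔¬halts P x) ¬halts)) ,
  complement-≤ᵀ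
    (λ P x halts conv → to (converges⇔¬halts P x) conv halts)
    (λ P x ¬halts ¬conv → ¬conv (from (converges⇔¬halts P x) ¬halts))
  where open Equivalence
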